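{- For every fixed integer $k \ge 1$, there are only finitely many (up to isomorphism) $k$-vertex-critical $(P_5, \overline{K_3+2P_1})$-free graphs.
   Context: All graphs are finite, simple and undirected. $P_t$ denotes the path on $t$ vertices, $K_n$ the complete graph on $n$ vertices, $G+H$ the disjoint union of $G$ and $H$, $2P_1$ two isolated vertices, and $\overline{G}$ the complement of $G$; thus $\overline{K_3+2P_1}$ is the complement of the disjoint union of a triangle and two isolated vertices. A graph is $(H_1,H_2)$-free if it contains no induced subgraph isomorphic to $H_1$ or to $H_2$. A graph $G$ is $k$-vertex-critical if $\chi(G)=k$ and $\chi(G-v)<k$ for every vertex $v\in V(G)$, where $\chi$ is the chromatic number. -}

module Defs where

open import Data.Nat using (ℕ; zero; suc; _+_; _<_; _≤_; pred)
open import Data.Nat.Properties using (≡ᵇ⇒≡)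
open import Data.Bool using (Bool; true; false; not; _∨_; _∧_; if_then_else_)
open import Data.Bool.Properties using (∨-comm)
open import Data.Fin using (Fin; zero; suc; toℕ; punchIn; splitAt; _≟_)
open import Data.Fin.Properties using (toℕ-injective)
open import Data.Sum using (_⊎_; inj₁; inj₂)
open import Data.Product using (Σ; _×_; _,_; ∃)
open import Data.List using (List)
open import Data.List.Membership.Propositional using (_∈_)
open import Data.Empty using (⊥)
open import Relation.Nullary using (¬_; does; yes; no)
open import Relation.Binary.PropositionalEquality renaming (sym to ≡-sym)
open import Function.Bundles using (_↔_; Inverse)
open import Function.Definitions using (Injective)

record Graph (n : ℕ) : Set where
  field
    adj     : Fin n → Fin n → Bool
    adj-sym     : ∀ u v → adj u v ≡ adj v u
    adj-irrefl  : ∀ v → adj v v ≡ false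

open Graph public

AnyGraph : Set
AnyGraph = Σ ℕ Graph

_≅_ : ∀ {n m} → Graph n → Graph m → Set
_≅_ {n} {m} G H =
  Σ (Fin n ↔ Fin m) λ f →
    ∀ u v → adj H (Inverse.to f u) (Inverse.to f v) ≡ adj G u v

_⊑ᵢ_ : ∀ {n m} → Graph n → Graph m → Set
_⊑ᵢ_ {n} {m} H G =
  Σ (Fin n → Fin m) λ f →
    Injective _≡_ _≡_ f × (∀ u v → adj G (f u) (f v) ≡ adj H u v)

Free₂ : ∀ {n a b} → Graph a → Graph b → Graph n → Set
Free₂ H₁ H₂ G = ¬ (H₁ ⊑ᵢ G) × ¬ (H₂ ⊑ᵢ G)

ProperColouring : ∀ {n} → Graph n → (k : ℕ) → (Fin n → Fin k) → Set
ProperColouring G k c = ∀ u v → adj G u v ≡ true → ¬ (c u ≡ c v)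

Colourable : ∀ {n} → Graph n → ℕ → Set
Colourable {n} G k = Σ (Fin n → Fin k) (ProperColouring G k)

ChromaticNumber : ∀ {n} → Graph n → ℕ → Set
ChromaticNumber G k = Colourable G k × (∀ j → Colourable G j → k ≤ j)

delete : ∀ {n} → Graph n → Fin n → Graph (pred n)
delete {suc m} G v = record
  { adj    = λ u w → adj G (punchIn v u) (punchIn v w)
  ; adj-sym    = λ u w → adj-sym G (punchIn v u) (punchIn v w)
  ; adj-irrefl = λ u → adj-irrefl G (punchIn v u)
  }

VertexCritical : ∀ {n} → ℕ → Graph n → Set
VertexCritical {n} k G =
  ChromaticNumber G k ×
  (∀ (v : Fin n) → Σ ℕ λ j → j < k × ChromaticNumber (delete G v) j)

private
  ≡ᵇ-adj-irrefl : ∀ n → (suc n Data.Nat.≡ᵇ n) ≡ false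
  ≡ᵇ-adj-irrefl zero = refl
  ≡ᵇ-adj-irrefl (suc n) = ≡ᵇ-adj-irrefl n

P : (t : ℕ) → Graph t
P t = record
  { adj    = λ i j → (suc (toℕ i) Data.Nat.≡ᵇ toℕ j) ∨ (suc (toℕ j) Data.Nat.≡ᵇ toℕ i)
  ; adj-sym    = λ i j → ∨-comm (suc (toℕ i) Data.Nat.≡ᵇ toℕ j) _
  ; adj-irrefl = λ i → cong₂ _∨_ (≡ᵇ-adj-irrefl (toℕ i)) (≡ᵇ-adj-irrefl (toℕ i))
  }

private
  neq : ∀ {n} → Fin n → Fin n → Bool
  neq u v = not (does (u ≟ v))

  neq-adj-sym : ∀ {n} (u v : Fin n) → neq u v ≡ neq v u
  neq-adj-sym u v with u ≟ v | v ≟ u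
  ... | yes _ | yes _ = refl
  ... | no _  | no _  = refl
  ... | yes p | no q  = Data.Empty.⊥-elim (q (≡-sym p))
  ... | no p  | yes q = Data.Empty.⊥-elim (p (≡-sym q))

  neq-adj-irrefl : ∀ {n} (u : Fin n) → neq u u ≡ false
  neq-adj-irrefl u with u ≟ u
  ... | yes _ = refl
  ... | no p  = Data.Empty.⊥-elim (p refl)

K : (n : ℕ) → Graph n
K n = record { adj = neq ; adj-sym = neq-adj-sym ; adj-irrefl = neq-adj-irrefl }

E : (n : ℕ) → Graph n
E n = record { adj = λ _ _ → false ; adj-sym = λ _ _ → refl ; adj-irrefl = λ _ → refl }

complement : ∀ {n} → Graph n → Graph n
complement G = record
  { adj    = λ u v → neq u v ∧ not (adj G u v)
  ; adj-sym    = λ u v → cong₂ (λ a b → a ∧ not b) (neq-adj-sym u v) (adj-sym G u v)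
  ; adj-irrefl = λ u → cong (λ a → a ∧ not (adj G u u)) (neq-adj-irrefl u)
  }

private
  uadj : ∀ {n m} → Graph n → Graph m → Fin n ⊎ Fin m → Fin n ⊎ Fin m → Bool
  uadj G H (inj₁ u) (inj₁ v) = adj G u v
  uadj G H (inj₂ u) (inj₂ v) = adj H u v
  uadj G H (inj₁ _) (inj₂ _) = false
  uadj G H (inj₂ _) (inj₁ _) = false

  uadj-adj-sym : ∀ {n m} (G : Graph n) (H : Graph m) x y → uadj G H x y ≡ uadj G H y x
  uadj-adj-sym G H (inj₁ u) (inj₁ v) = adj-sym G u v
  uadj-adj-sym G H (inj₂ u) (inj₂ v) = adj-sym H u v
  uadj-adj-sym G H (inj₁ _) (inj₂ _) = refl
  uadj-adj-sym G H (inj₂ _) (inj₁ _) = refl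

  uadj-adj-irrefl : ∀ {n m} (G : Graph n) (H : Graph m) x → uadj G H x x ≡ false
  uadj-adj-irrefl G H (inj₁ u) = adj-irrefl G u
  uadj-adj-irrefl G H (inj₂ u) = adj-irrefl H u

_⊕_ : ∀ {n m} → Graph n → Graph m → Graph (n + m)
_⊕_ {n} G H = record
  { adj    = λ u v → uadj G H (splitAt n u) (splitAt n v)
  ; adj-sym    = λ u v → uadj-adj-sym G H (splitAt n u) (splitAt n v)
  ; adj-irrefl = λ u → uadj-adj-irrefl G H (splitAt n u)
  }

co-K3+2P1 : Graph 5
co-K3+2P1 = complement (K 3 ⊕ E 2)

FinitelyManyUpToIso : (∀ {n} → Graph n → Set) → Set
FinitelyManyUpToIso Prop =
  Σ (List AnyGraph) λ L →
    ∀ {n} (G : Graph n) → Prop G →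
      Σ AnyGraph λ H → (H ∈ L) × (G ≅ Data.Product.proj₂ H)

-- Two adjacent vertices have boundedly many common neighbours, by Ramsey: a large common neighbourhood
-- contains three independent vertices, which with the edge form the complement of K₃+2P₁, or a large clique.
-- Hence each neighbourhood N(v) induces a graph of bounded degree, which by P₅-freeness splits into
-- components of bounded size. If N(v) is huge, many components share one adjacency pattern.
-- A vertex w outside N(v) meets each of them not at all, partially or completely; the induced P₅s
-- through v and w make these statuses so close to a chain (up to one complementary pair of classes)
-- that some component is dominated by another. Folding the first onto the second is then an
-- endomorphism missing a vertex, which a critical graph does not have. So degrees are bounded, and
-- since a critical graph is connected and P₅-free connected graphs have diameter at most 3, so is
-- the number of vertices.
module Submission where

open import Defs
open import Data.Nat using (ℕ; zero; suc; _+_; _*_; _^_; _≤_; _<_; z≤n; s≤s; _≤?_; _<?_)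
open import Data.Nat.Properties
  using (≤-refl; ≤-antisym; n≤0⇒n≡0; ≤-trans; ≤-reflexive; <-trans; ≤-<-trans; <-≤-trans; <-irrefl; <⇒≱; ≰⇒>; ≮⇒≥; 1+n≰n;
         ≤-pred; +-mono-≤; +-identityʳ; +-suc; n≤1+n)
open import Data.Bool using (Bool; true; false; _∧_; _∨_)
open import Data.Bool.Properties using (∨-comm; ∧-zeroʳ) renaming (_≟_ to _≟ᵇ_)
open import Data.Empty using (⊥; ⊥-elim)
open import Data.Unit using (⊤; tt)
open import Data.Fin using (Fin; zero; suc; toℕ; inject≤; punchOut; combine; remQuot; funToFin; finToFun; _≟_)
open import Data.Fin.Properties
  using (any?; 2↔Bool; remQuot-combine; finToFun-funToFin; inject≤-injective;
         punchIn-punchOut; injective⇒≤; toℕ-inject≤)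
open import Data.List using (List; []; _∷_; length; lookup; map; filter; concatMap; allFin; upTo)
open import Data.List.Properties using (length-tabulate)
open import Data.List.Membership.Propositional using (_∈_; lose)
open import Data.List.Membership.Propositional.Properties
  using (∈-map⁺; ∈-concatMap⁺; ∈-upTo⁺; ∈-filter⁺; ∈-allFin; ∈-lookup)
open import Data.List.Relation.Unary.All as All using (All; []; _∷_)
open import Data.List.Relation.Unary.All.Properties using (all-filter)
open import Data.List.Relation.Unary.AllPairs using (AllPairs; []; _∷_)
open import Data.List.Relation.Unary.Any as Any using (Any; here; there)
open import Data.List.Relation.Unary.Unique.Propositional using (Unique)
open import Data.List.Relation.Unary.Unique.Propositional.Properties using (allFin⁺; filter⁺)
open import Data.Product using (Σ; ∃; _×_; _,_; proj₁; proj₂; uncurry)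
open import Data.Sum using (_⊎_; inj₁; inj₂; [_,_]′)
open import Data.Vec as Vec using ([]; _∷_)
open import Function using (_∘_; id)
open import Function.Bundles using (Inverse)
open import Function.Construct.Identity using (↔-id)
open import Relation.Nullary using (¬_; Dec; yes; no; contradiction)
open import Relation.Nullary.Decidable using (_×-dec_; _⊎-dec_)
open import Relation.Unary using (Decidable; _⊆_)
open import Relation.Binary.PropositionalEquality
  using (_≡_; _≢_; refl; sym; trans; cong; cong₂; subst; subst₂)

-- Cardinality bounds by duplicate-free lists.

-- Quantifying over duplicate-free lists bounds a predicate without deciding or enumerating it.
AtMost : {A : Set} → ℕ → (A → Set) → Set
AtMost {A} m Φ = (xs : List A) → Unique xs → All Φ xs → length xs ≤ m

module _ {A : Set} where

  private variable
    Φ Ψ : A → Set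
    a b : ℕ

  atMost-⊆ : (∀ {x} → Φ x → Ψ x) → AtMost a Ψ → AtMost a Φ
  atMost-⊆ Φ⊆Ψ bound xs u ps = bound xs u (All.map Φ⊆Ψ ps)

  atMost-unless : (∀ (xs : List A) → a < length xs → Unique xs → All Φ xs → ⊥) → AtMost a Φ
  atMost-unless {a} never xs u ps with length xs ≤? a
  ... | yes le = le
  ... | no nle = ⊥-elim (never xs (≰⇒> nle) u ps)

  atMost-unique : (∀ {x y} → Φ x → Φ y → x ≡ y) → AtMost 1 Φ
  atMost-unique eq [] _ _ = z≤n
  atMost-unique eq (x ∷ []) _ _ = s≤s z≤n
  atMost-unique eq (x ∷ y ∷ xs) ((x≢y ∷ _) ∷ _) (px ∷ py ∷ _) = contradiction (eq px py) x≢y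

  private
    separate : ∀ xs → Unique xs → All (λ x → Φ x ⊎ Ψ x) xs →
      ∃ λ ys → ∃ λ zs → (Unique ys × All (λ y → Φ y × y ∈ xs) ys) ×
                        (Unique zs × All (λ z → Ψ z × z ∈ xs) zs) ×
                        length xs ≤ length ys + length zs
    separate [] [] [] = [] , [] , ([] , []) , ([] , []) , z≤n
    separate (x ∷ xs) (x∉ ∷ u) (pq ∷ pqs)
      with ys , zs , (uy , py) , (uz , qz) , le ← separate xs u pqs
      with pq
    ... | inj₁ p = x ∷ ys , zs
          , (All.map (λ (_ , m) → All.lookup x∉ m) py ∷ uy
            , (p , here refl) ∷ All.map (λ (q , m) → q , there m) py)
          , (uz , All.map (λ (q , m) → q , there m) qz) , s≤s le
    ... | inj₂ q = ys , x ∷ zs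
          , (uy , All.map (λ (q , m) → q , there m) py)
          , (All.map (λ (_ , m) → All.lookup x∉ m) qz ∷ uz
            , (q , here refl) ∷ All.map (λ (q , m) → q , there m) qz)
          , ≤-trans (s≤s le) (≤-reflexive (sym (+-suc (length ys) (length zs))))

  atMost-⊎ : AtMost a Φ → AtMost b Ψ → AtMost (a + b) (λ x → Φ x ⊎ Ψ x)
  atMost-⊎ boundΦ boundΨ xs u pqs
    with ys , zs , (uy , py) , (uz , qz) , le ← separate xs u pqs =
    ≤-trans le (+-mono-≤ (boundΦ ys uy (All.map proj₁ py)) (boundΨ zs uz (All.map proj₁ qz)))

  atMost-Any : {B : Set} {R : B → A → Set} → (∀ y → AtMost a (R y)) →
    ∀ ys → length ys ≤ b → AtMost (b * a) (λ x → Any (λ y → R y x) ys)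
  atMost-Any bound [] _ [] _ _ = z≤n
  atMost-Any bound [] _ (_ ∷ _) _ (() ∷ _)
  atMost-Any bound (y ∷ ys) (s≤s le) =
    atMost-⊆ (λ { (here r) → inj₁ r ; (there r) → inj₂ r })
      (atMost-⊎ (bound y) (atMost-Any bound ys le))

  -- Each element of `R` picks a linked element of `Φ`; a link determines its left end, so the picks
  -- are distinct.
  atMost-transport : {B : Set} {R : B → Set} {T : B → A → Set} → AtMost a Φ →
    (∀ {i} → R i → ∃ λ x → Φ x × T i x) → (∀ {i j x} → T i x → T j x → i ≡ j) →
    AtMost a R
  atMost-transport {Φ = Φ} {B} {R} {T} bound image injective is u rs =
    let xs , ux , px , _ , eq = images is u rs in ≤-trans (≤-reflexive (sym eq)) (bound xs ux px)
    where
    images : ∀ is → Unique is → All R is → ∃ λ xs →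
      Unique xs × All Φ xs × All (λ x → ∃ λ i → T i x × i ∈ is) xs × length xs ≡ length is
    images [] [] [] = [] , [] , [] , [] , refl
    images (i ∷ is) (i∉ ∷ u) (r ∷ rs)
      with xs , ux , px , tx , eq ← images is u rs | x , p , t ← image r =
      x ∷ xs
      , All.map (λ { (j , t′ , j∈) refl → All.lookup i∉ j∈ (injective t t′) }) tx ∷ ux
      , p ∷ px
      , (i , t , here refl) ∷ All.map (λ (j , t′ , j∈) → j , t′ , there j∈) tx
      , cong suc eq

-- Counting the columns of an almost chain-ordered table of statuses.

-- `sideBound` is the count 1 + 2M of `few` below, plus one so that it is also at least 2.
-- `indexBound` adds the five classes of `conflict⇒bounded`: 1, 1, M and two sides.
sideBound indexBound : ℕ → ℕ
sideBound M = suc (suc (M + M))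
indexBound M = suc (suc (M + (sideBound M + sideBound M)))

-- Read s w i as the adjacency of a vertex w to a block i: 0 none, 1 partial, 2 complete.
module Comparability
  {Row I : Set} (_~_ : Row → Row → Set) (~-sym : ∀ {w y} → w ~ y → y ~ w)
  (_~?_ : ∀ w y → Dec (w ~ y)) (_≟ᴵ_ : (i j : I) → Dec (i ≡ j))
  (s : Row → I → ℕ) (s≤2 : ∀ w i → s w i ≤ 2) (M : ℕ)
  (partial-unique : ∀ {w i j} → s w i ≡ 1 → s w j ≡ 1 → i ≡ j)
  (conflict⇒~ : ∀ {w y i j} → s y i < s w i → s w j < s y j → w ~ y)
  (~-covers : ∀ {w y i j} → w ~ y → s y i < s w i → j ≢ i → 2 ≤ s w j + s y j)
  (~-overlap : ∀ {w y} → w ~ y → AtMost M (λ i → 3 ≤ s w i + s y i))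
  (incomparable : ∀ {i j} → i ≢ j → ∃ λ w → s w j < s w i)
  where

  Conflict : I → I → Row → Row → Set
  Conflict i j w y = s y i < s w i × s w j < s y j

  Partial : I → Set
  Partial i = ∃ λ w → s w i ≡ 1

  <-chain : ∀ {a b c d} → a < b → b ≤ c → c < d → d ≤ 2 → a ≡ 0 × b ≡ 1 × c ≡ 1 × d ≡ 2
  <-chain a<b b≤c c<d d≤2 =
    n≤0⇒n≡0 (≤-pred (≤-trans a<b b≤1)) , ≤-antisym b≤1 1≤b , ≤-antisym c≤1 (≤-trans 1≤b b≤c) ,
    ≤-antisym d≤2 (≤-<-trans (≤-trans 1≤b b≤c) c<d)
    where
    1≤b = ≤-<-trans z≤n a<b
    c≤1 = ≤-pred (≤-trans c<d d≤2)
    b≤1 = ≤-trans b≤c c≤1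

  module _ {J : I → Set} (conflict-free : ∀ {i j w y} → J i → J j → ¬ Conflict i j w y) where

    -- The inequalities force the values 0, 1, 1, 2. A row `u` partial at `i` would be 0 or 2 at `j`
    -- by `partial-unique`, and so conflict with `y` or with `w` respectively.
    chain⇒partial : ∀ {i j w y} → J i → J j → i ≢ j →
      s y i < s y j → s y j ≤ s w j → s w j < s w i → Partial j × ¬ Partial i
    chain⇒partial {i} {j} {w} {y} Ji Jj i≢j p q r
      with yi , yj , wj , wi ← <-chain p q r (s≤2 w i) = (w , wj) , absurd
      where
      absurd : ¬ Partial i
      absurd (u , ui) with s u j in uj | s≤2 u j
      ... | 0 | _ = conflict-free Ji Jj
              ( subst₂ _<_ (sym yi) (sym ui) (s≤s z≤n) , subst₂ _<_ (sym uj) (sym yj) (s≤s z≤n) )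
      ... | 1 | _ = i≢j (partial-unique ui uj)
      ... | 2 | _ = conflict-free Ji Jj
              ( subst₂ _<_ (sym ui) (sym wi) ≤-refl , subst₂ _<_ (sym wj) (sym uj) ≤-refl )
      ... | suc (suc (suc _)) | s≤s (s≤s ())

    -- Incomparability supplies a row favouring each index. Without a conflict their four values
    -- form a chain, in one order or the other.
    exactly-one-partial : ∀ {i j} → J i → J j → i ≢ j →
      (Partial i × ¬ Partial j) ⊎ (Partial j × ¬ Partial i)
    exactly-one-partial {i} {j} Ji Jj i≢j
      with w , w< ← incomparable i≢j | y , y< ← incomparable (i≢j ∘ sym)
      with s y i <? s w i
    ... | yes p = inj₂ (chain⇒partial Ji Jj i≢j y< (≮⇒≥ (λ q → conflict-free Ji Jj (p , q))) w<)
    ... | no p = inj₁ (chain⇒partial Jj Ji (i≢j ∘ sym) w< (≮⇒≥ p) y<)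

    -- Any two indices differ in being `Partial`, which three indices cannot do pairwise.
    conflict-free⇒≤2 : AtMost 2 J
    conflict-free⇒≤2 [] _ _ = z≤n
    conflict-free⇒≤2 (_ ∷ []) _ _ = s≤s z≤n
    conflict-free⇒≤2 (_ ∷ _ ∷ []) _ _ = s≤s (s≤s z≤n)
    conflict-free⇒≤2 (i ∷ j ∷ l ∷ _) ((i≢j ∷ i≢l ∷ _) ∷ (j≢l ∷ _) ∷ _) (Ji ∷ Jj ∷ Jl ∷ _)
      with exactly-one-partial Ji Jj i≢j | exactly-one-partial Ji Jl i≢l | exactly-one-partial Jj Jl j≢l
    ... | inj₁ (pi , ¬pj) | inj₁ (_ , ¬pl) | inj₁ (pj , _) = contradiction pj ¬pj
    ... | inj₁ (pi , ¬pj) | inj₁ (_ , ¬pl) | inj₂ (pl , _) = contradiction pl ¬pl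
    ... | inj₁ (pi , ¬pj) | inj₂ (_ , ¬pi) | _ = contradiction pi ¬pi
    ... | inj₂ (pj , ¬pi) | inj₁ (pi , _) | _ = contradiction pi ¬pi
    ... | inj₂ (pj , ¬pi) | inj₂ (pl , _) | inj₁ (_ , ¬pl) = contradiction pl ¬pl
    ... | inj₂ (pj , ¬pi) | inj₂ (pl , _) | inj₂ (_ , ¬pj) = contradiction pj ¬pj

  -- The rows w₁ ~ y₁ of a conflict are nearly complementary; a second conflict among the indices
  -- on w₁'s side would make w₁ dominate y₁ everywhere else.
  side-bounded : ∀ {i₀ j₀ w₁ y₁} → Conflict i₀ j₀ w₁ y₁ →
    AtMost (sideBound M) (λ l → s w₁ l ≡ 2 × s y₁ l ≡ 0)
  side-bounded {i₀} {j₀} {w₁} {y₁} (_ , w₁<y₁) =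
    atMost-unless λ xs big u ps →
      <⇒≱ big (≤-trans (conflict-free⇒≤2 (conflict-free xs big u ps) xs u ps) (s≤s (s≤s z≤n)))
    where
    J : I → Set
    J l = s w₁ l ≡ 2 × s y₁ l ≡ 0

    -- Otherwise `w`, being below `w₁` at `j`, never exceeds `w₁`. Nor is it related to `y₁`, as the
    -- two would fail to cover `j`; being above `y₁` at `i`, it is then nowhere below. So `w` lies
    -- pointwise between `y₁` and `w₁`, against their conflict at `j₀`.
    conflict-adjacent : ∀ {w z i j} → J i → J j → Conflict i j w z → w₁ ~ w
    conflict-adjacent {w} {z} {i} {j} (_ , y₁i) (w₁j , y₁j) (z<w , w<z) with w₁ ~? w
    ... | yes w₁~w = w₁~w
    ... | no w₁≁w = ⊥-elim (<⇒≱ w₁<y₁ (≤-trans (y₁≤w j₀) (w≤w₁ j₀)))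
      where
      y₁<w : s y₁ i < s w i
      y₁<w = subst (_< s w i) (sym y₁i) (≤-<-trans z≤n z<w)

      w<2 : s w j < 2
      w<2 = <-≤-trans w<z (s≤2 z j)

      j≢i : j ≢ i
      j≢i refl = <-irrefl refl (<-trans z<w w<z)

      w≁y₁ : ¬ (w ~ y₁)
      w≁y₁ w~y₁ = <⇒≱ w<2
        (subst (2 ≤_) (trans (cong (s w j +_) y₁j) (+-identityʳ _)) (~-covers w~y₁ y₁<w j≢i))

      w≤w₁ : ∀ l → s w l ≤ s w₁ l
      w≤w₁ l = ≮⇒≥ λ w₁<w →
        w₁≁w (conflict⇒~ (subst (s w j <_) (sym w₁j) w<2) w₁<w)

      y₁≤w : ∀ l → s y₁ l ≤ s w l
      y₁≤w l = ≮⇒≥ λ w<y₁ → w≁y₁ (conflict⇒~ y₁<w w<y₁)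

    -- Both rows of a further conflict are related to `w₁` and together cover every `l` other than
    -- `i`. One of them is nonzero there and so overlaps `w₁`, whose value is 2; this leaves `J` at
    -- most 1 + 2M elements.
    conflict-free : ∀ xs → sideBound M < length xs → Unique xs → All J xs →
      ∀ {i j w z} → J i → J j → ¬ Conflict i j w z
    conflict-free xs big u ps {i} {j} {w} {z} Ji Jj c@(z<w , w<z) =
      <⇒≱ big (≤-trans (few xs u ps) (n≤1+n _))
      where
      w₁~w : w₁ ~ w
      w₁~w = conflict-adjacent Ji Jj c

      w₁~z : w₁ ~ z
      w₁~z = conflict-adjacent Jj Ji (w<z , z<w)

      3≤2+ : ∀ {a} b → a ≡ 2 → 0 < b → 3 ≤ a + b
      3≤2+ (suc b) refl _ = s≤s (s≤s (s≤s z≤n))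

      cases : ∀ {l} → J l → (l ≡ i) ⊎ ((3 ≤ s w₁ l + s w l) ⊎ (3 ≤ s w₁ l + s z l))
      cases {l} (w₁l , _) with l ≟ᴵ i
      ... | yes l≡i = inj₁ l≡i
      ... | no l≢i with s w l in wl | s z l in zl | ~-covers {j = l} (conflict⇒~ z<w w<z) z<w l≢i
      ...   | suc m | _ | _ = inj₂ (inj₁ (3≤2+ (suc m) w₁l (s≤s z≤n)))
      ...   | 0 | suc m | _ = inj₂ (inj₂ (3≤2+ (suc m) w₁l (s≤s z≤n)))
      ...   | 0 | 0 | ()

      few : AtMost (1 + (M + M)) J
      few = atMost-⊆ cases (atMost-⊎ (atMost-unique (λ p q → trans p (sym q)))
              (atMost-⊎ (~-overlap w₁~w) (~-overlap w₁~z)))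

  -- Away from `i₀`, covering excludes the value pairs (0,0) and (0,1). What remains is `w₁`
  -- partial, a sum of at least 3, or one of the sides (2,0) and (0,2).
  conflict⇒bounded : ∀ {i₀ j₀ w₁ y₁} → Conflict i₀ j₀ w₁ y₁ → AtMost (indexBound M) (λ (_ : I) → ⊤)
  conflict⇒bounded {i₀} {j₀} {w₁} {y₁} c@(y₁<w₁ , w₁<y₁) =
    atMost-⊆ (λ {l} _ → cases l)
      (atMost-⊎ (atMost-unique (λ p q → trans p (sym q)))
        (atMost-⊎ {a = 1} (atMost-unique partial-unique)
          (atMost-⊎ (~-overlap (conflict⇒~ y₁<w₁ w₁<y₁))
            (atMost-⊎ (side-bounded c) (side-bounded (w₁<y₁ , y₁<w₁))))))
    where
    cases : ∀ l → (l ≡ i₀) ⊎ ((s w₁ l ≡ 1) ⊎ ((3 ≤ s w₁ l + s y₁ l) ⊎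
                    ((s w₁ l ≡ 2 × s y₁ l ≡ 0) ⊎ (s y₁ l ≡ 2 × s w₁ l ≡ 0))))
    cases l with l ≟ᴵ i₀
    ... | yes l≡i₀ = inj₁ l≡i₀
    ... | no l≢i₀ with s w₁ l | s y₁ l | ~-covers {j = l} (conflict⇒~ y₁<w₁ w₁<y₁) y₁<w₁ l≢i₀
                     | s≤2 w₁ l
    ...   | 0 | 0 | () | _
    ...   | 0 | 1 | s≤s () | _
    ...   | 0 | 2 | _ | _ = inj₂ (inj₂ (inj₂ (inj₂ (refl , refl))))
    ...   | 0 | suc (suc (suc m)) | _ | _ = inj₂ (inj₂ (inj₁ (s≤s (s≤s (s≤s z≤n)))))
    ...   | 1 | _ | _ | _ = inj₂ (inj₁ refl)
    ...   | 2 | 0 | _ | _ = inj₂ (inj₂ (inj₂ (inj₁ (refl , refl))))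
    ...   | 2 | suc m | _ | _ = inj₂ (inj₂ (inj₁ (s≤s (s≤s (s≤s z≤n)))))
    ...   | suc (suc (suc _)) | _ | _ | s≤s (s≤s ())

  -- In a longer list no conflict can exist, and then two indices are already the maximum.
  indices-bounded : AtMost (indexBound M) (λ (_ : I) → ⊤)
  indices-bounded = atMost-unless λ xs big u ps →
    <⇒≱ big (≤-trans
      (conflict-free⇒≤2 (λ _ _ c → <⇒≱ big (conflict⇒bounded c xs u ps)) xs u ps)
      (s≤s (s≤s z≤n)))

-- Pairwise relations in lists; coding of Boolean matrices.

allPairs-lookup : {A : Set} {R : A → A → Set} → (∀ {x y} → R x y → R y x) →
  ∀ {xs} → AllPairs R xs → ∀ i j → i ≢ j → R (lookup xs i) (lookup xs j)
allPairs-lookup R-sym (_ ∷ _) zero zero i≢j = contradiction refl i≢j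
allPairs-lookup R-sym (r ∷ _) zero (suc j) _ = All.lookup r (∈-lookup j)
allPairs-lookup R-sym (r ∷ _) (suc i) zero _ = R-sym (All.lookup r (∈-lookup i))
allPairs-lookup R-sym (_ ∷ rs) (suc i) (suc j) i≢j =
  allPairs-lookup R-sym rs i j (i≢j ∘ cong suc)

allPairs-∈ : {A : Set} {R : A → A → Set} → (∀ {x y} → R x y → R y x) →
  ∀ {xs} → AllPairs R xs → ∀ {x y} → x ∈ xs → y ∈ xs → x ≢ y → R x y
allPairs-∈ R-sym (_ ∷ _) (here refl) (here refl) x≢y = contradiction refl x≢y
allPairs-∈ R-sym (r ∷ _) (here refl) (there y∈) _ = All.lookup r y∈
allPairs-∈ R-sym (r ∷ _) (there x∈) (here refl) _ = R-sym (All.lookup r x∈)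
allPairs-∈ R-sym (_ ∷ rs) (there x∈) (there y∈) x≢y = allPairs-∈ R-sym rs x∈ y∈ x≢y

-- The codes serve both to classify components and to list all graphs.
encode : ∀ {n} → (Fin n → Fin n → Bool) → Fin (2 ^ (n * n))
encode {n} f = funToFin λ p → Inverse.from 2↔Bool (uncurry f (remQuot n p))

decode : ∀ {n} → Fin (2 ^ (n * n)) → Fin n → Fin n → Bool
decode c i j = Inverse.to 2↔Bool (finToFun c (combine i j))

decode-encode : ∀ {n} (f : Fin n → Fin n → Bool) i j → decode (encode f) i j ≡ f i j
decode-encode {n} f i j =
  trans (cong (Inverse.to 2↔Bool) (finToFun-funToFin _ (combine i j)))
    (trans (Inverse.strictlyInverseˡ 2↔Bool _) (cong (uncurry f) (remQuot-combine i j)))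

-- Forbidden induced subgraphs.

module _ {n} (G : Graph n) where

  adj-or-not : ∀ x y → adj G x y ≡ true ⊎ adj G x y ≡ false
  adj-or-not x y with adj G x y
  ... | true = inj₁ refl
  ... | false = inj₂ refl

  adj-not-both : ∀ {x y} → adj G x y ≡ true → adj G x y ≡ false → ⊥
  adj-not-both t f with () ← trans (sym t) f

  adj-swap : ∀ {x y b} → adj G x y ≡ b → adj G y x ≡ b
  adj-swap {x} {y} e = trans (adj-sym G y x) e

  adj⇒≢ : ∀ {x y} → adj G x y ≡ true → x ≢ y
  adj⇒≢ {x} e refl = adj-not-both e (adj-irrefl G x)

  separated⇒≢ : ∀ {x y z} → adj G x z ≡ true → adj G y z ≡ false → x ≢ y
  separated⇒≢ t f refl = adj-not-both t f

  -- Symmetry and irreflexivity leave only the pairs `i < j` to check.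
  induced : ∀ {m} (H : Graph m) (f : Fin m → Fin n) →
    AllPairs (λ i j → f i ≢ f j × adj G (f i) (f j) ≡ adj H i j) (allFin m) → H ⊑ᵢ G
  induced {m} H f pairs = f , injective , matches
    where
    at : ∀ i j → i ≢ j → f i ≢ f j × adj G (f i) (f j) ≡ adj H i j
    at i j = allPairs-∈
      (λ {i} {j} (f≢ , e) → f≢ ∘ sym , trans (adj-sym G _ _) (trans e (adj-sym H i j)))
      pairs (∈-allFin i) (∈-allFin j)

    injective : ∀ {i j} → f i ≡ f j → i ≡ j
    injective {i} {j} e with i ≟ j
    ... | yes i≡j = i≡j
    ... | no i≢j = contradiction e (proj₁ (at i j i≢j))

    matches : ∀ i j → adj G (f i) (f j) ≡ adj H i j
    matches i j with i ≟ j
    ... | yes refl = trans (adj-irrefl G (f i)) (sym (adj-irrefl H i))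
    ... | no i≢j = proj₂ (at i j i≢j)

  -- Nonconsecutive vertices are distinct because a third vertex of the path is adjacent to exactly
  -- one of them.
  no-P5 : ¬ (P 5 ⊑ᵢ G) → ∀ {a b c d e} →
    adj G a b ≡ true → adj G b c ≡ true → adj G c d ≡ true → adj G d e ≡ true →
    adj G a c ≡ false → adj G a d ≡ false → adj G a e ≡ false →
    adj G b d ≡ false → adj G b e ≡ false → adj G c e ≡ false → ⊥
  no-P5 free {a} {b} {c} {d} {e} ab bc cd de ac ad ae bd be ce =
    free (induced (P 5) (Vec.lookup (a ∷ b ∷ c ∷ d ∷ e ∷ []))
      ( ((adj⇒≢ ab , ab) ∷ (separated⇒≢ cd ad ∘ sym , ac) ∷
         (separated⇒≢ de ae ∘ sym , ad) ∷ (separated⇒≢ ab (adj-swap be) , ae) ∷ [])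
      ∷ ((adj⇒≢ bc , bc) ∷ (separated⇒≢ (adj-swap ab) (adj-swap ad) , bd) ∷
         (separated⇒≢ (adj-swap ab) (adj-swap ae) , be) ∷ [])
      ∷ ((adj⇒≢ cd , cd) ∷ (separated⇒≢ (adj-swap bc) (adj-swap be) , ce) ∷ [])
      ∷ ((adj⇒≢ de , de) ∷ [])
      ∷ [] ∷ []))

  no-co-K3+2P1 : ¬ (co-K3+2P1 ⊑ᵢ G) → ∀ {a b c x y} → adj G x y ≡ true →
    adj G x a ≡ true × adj G y a ≡ true → adj G x b ≡ true × adj G y b ≡ true →
    adj G x c ≡ true × adj G y c ≡ true → a ≢ b → a ≢ c → b ≢ c →
    adj G a b ≡ false → adj G a c ≡ false → adj G b c ≡ false → ⊥
  no-co-K3+2P1 free {a} {b} {c} {x} {y} xy (xa , ya) (xb , yb) (xc , yc) a≢b a≢c b≢c ab ac bc =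
    free (induced co-K3+2P1 (Vec.lookup (a ∷ b ∷ c ∷ x ∷ y ∷ []))
      ( ((a≢b , ab) ∷ (a≢c , ac) ∷ edge xa ∷ edge ya ∷ [])
      ∷ ((b≢c , bc) ∷ edge xb ∷ edge yb ∷ [])
      ∷ (edge xc ∷ edge yc ∷ [])
      ∷ ((adj⇒≢ xy , xy) ∷ [])
      ∷ [] ∷ []))
    where
    edge : ∀ {u v} → adj G v u ≡ true → u ≢ v × adj G u v ≡ true
    edge e = adj⇒≢ e ∘ sym , adj-swap e

  clique-bounded : ∀ {k xs} → Colourable G k → AllPairs (λ x y → adj G x y ≡ true) xs →
    length xs ≤ k
  clique-bounded {xs = xs} (c , proper) clique = injective⇒≤ {f = c ∘ lookup xs} injective
    where
    injective : ∀ {i j} → c (lookup xs i) ≡ c (lookup xs j) → i ≡ j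
    injective {i} {j} e with i ≟ j
    ... | yes i≡j = i≡j
    ... | no i≢j = contradiction e (proper _ _ (allPairs-lookup adj-swap clique i j i≢j))

-- Ramsey bound for common neighbourhoods.

-- An upper bound for R(3, c+1) - 1, equal to c(c+3)/2.
ramsey : ℕ → ℕ
ramsey zero = zero
ramsey (suc c) = suc (ramsey c + suc c)

module _ {n} (G : Graph n) where

  NoIndependentTriple : (Fin n → Set) → Set
  NoIndependentTriple S = ∀ {a b c} → S a → S b → S c → a ≢ b → a ≢ c → b ≢ c →
    adj G a b ≡ false → adj G a c ≡ false → adj G b c ≡ false → ⊥

  Clique : List (Fin n) → Set
  Clique = AllPairs (λ x y → adj G x y ≡ true)

  -- Pivot on the head `x`. Cliques among its neighbours extend by `x`, so their bound drops by one;
  -- two nonadjacent nonneighbours would form an independent triple with `x`, so the nonneighbours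
  -- are a clique.
  ramsey-bound : ∀ c {S} → NoIndependentTriple S → (∀ xs → Clique xs → All S xs → length xs ≤ c) →
    AtMost (ramsey c) S
  ramsey-bound c triple-free cliques [] _ _ = z≤n
  ramsey-bound zero triple-free cliques (x ∷ xs) _ (sx ∷ _) =
    contradiction (cliques (x ∷ []) ([] ∷ []) (sx ∷ [])) 1+n≰n
  ramsey-bound (suc c) {S} triple-free cliques (x ∷ xs) (x∉ ∷ u) (sx ∷ ss) =
    s≤s (atMost-⊎ neighbours nonneighbours xs u (All.map split (All.zip (x∉ , ss))))
    where
    split : ∀ {y} → x ≢ y × S y →
      (S y × adj G x y ≡ true) ⊎ (S y × x ≢ y × adj G x y ≡ false)
    split {y} (x≢y , sy) with adj-or-not G x y
    ... | inj₁ t = inj₁ (sy , t)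
    ... | inj₂ f = inj₂ (sy , x≢y , f)

    neighbours : AtMost (ramsey c) (λ y → S y × adj G x y ≡ true)
    neighbours = ramsey-bound c
      (λ (sa , _) (sb , _) (sc , _) → triple-free sa sb sc)
      (λ ys clique all → ≤-pred
        (cliques (x ∷ ys) (All.map proj₂ all ∷ clique) (sx ∷ All.map proj₁ all)))

    nonneighbours : AtMost (suc c) (λ y → S y × x ≢ y × adj G x y ≡ false)
    nonneighbours ys uy all = cliques ys (clique ys uy all) (All.map proj₁ all)
      where
      clique : ∀ ys → Unique ys → All (λ y → S y × x ≢ y × adj G x y ≡ false) ys → Clique ys
      clique [] _ _ = []
      clique (y ∷ ys) (y∉ ∷ u) ((sy , x≢y , xy) ∷ all) =
        All.map (λ {z} (y≢z , sz , x≢z , xz) →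
                   [ id , (λ yz → ⊥-elim (triple-free sx sy sz x≢y x≢z y≢z xy xz yz)) ]′
                     (adj-or-not G y z))
                (All.zip (y∉ , all))
        ∷ clique ys u all

  codegree-bounded : ∀ {k} → Colourable G k → ¬ (co-K3+2P1 ⊑ᵢ G) → ∀ {x y} → adj G x y ≡ true →
    AtMost (ramsey k) (λ a → adj G x a ≡ true × adj G y a ≡ true)
  codegree-bounded {k} colouring free xy =
    ramsey-bound k (no-co-K3+2P1 G free xy) (λ _ clique _ → clique-bounded G colouring clique)

-- Rigidity and connectedness of vertex-critical graphs.

delete-colouring : ∀ {n j} (G : Graph n) v → Colourable (delete G v) j →
  Σ (∀ x → x ≢ v → Fin j) λ c → ∀ {x y} p q → adj G x y ≡ true → c x p ≢ c y q
delete-colouring {suc _} G v (c , proper) =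
  (λ x x≢v → c (punchOut (x≢v ∘ sym))) ,
  λ p q e → proper _ _ (trans (cong₂ (adj G) (punchIn-punchOut _) (punchIn-punchOut _)) e)

-- Composed with a colouring of `delete G v`, such a map would colour `G` with fewer than `k`
-- colours.
no-proper-endomorphism : ∀ {n k} {G : Graph n} → VertexCritical k G → ∀ v (r : Fin n → Fin n) →
  (∀ x → r x ≢ v) → ¬ (∀ {x y} → adj G x y ≡ true → adj G (r x) (r y) ≡ true)
no-proper-endomorphism {G = G} ((_ , minimal) , smaller) v r avoids hom
  with j , j<k , col , _ ← smaller v
  with c , proper ← delete-colouring G v col =
  <⇒≱ j<k (minimal j ((λ x → c (r x) (avoids x)) , λ x y e → proper _ _ (hom e)))

-- If `u` lay outside `X`, a colouring of G - u used on `X` and one of G - v used off `X` would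
-- combine, as no edge crosses, into a colouring of `G` with too few colours.
critical⇒connected : ∀ {n k} {G : Graph n} → VertexCritical k G → {X : Fin n → Set} → Decidable X →
  (∀ {x y} → X x → adj G x y ≡ true → X y) → ∀ {v} → X v → ∀ u → X u
critical⇒connected {k = zero} (_ , smaller) _ _ _ u with () ← proj₁ (proj₂ (smaller u))
critical⇒connected {n} {suc k} {G} ((_ , minimal) , smaller) {X} X? closed {v} Xv u with X? u
... | yes Xu = Xu
... | no ¬Xu
  with i , s≤s i≤ , colᵤ , _ ← smaller u | j , s≤s j≤ , colᵥ , _ ← smaller v
  with cᵤ , properᵤ ← delete-colouring G u colᵤ | cᵥ , properᵥ ← delete-colouring G v colᵥ
  = contradiction (minimal k (colour , proper)) 1+n≰n
  where
  colour : Fin n → Fin k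
  colour x with X? x
  ... | yes Xx = inject≤ (cᵤ x (λ { refl → ¬Xu Xx })) i≤
  ... | no ¬Xx = inject≤ (cᵥ x (λ { refl → ¬Xx Xv })) j≤

  proper : ProperColouring G k colour
  proper x y e with X? x | X? y
  ... | yes Xx | yes _ = properᵤ _ _ e ∘ inject≤-injective i≤ i≤ _ _
  ... | yes Xx | no ¬Xy = contradiction (closed Xx e) ¬Xy
  ... | no ¬Xx | yes Xy = contradiction (closed Xy (adj-swap G e)) ¬Xx
  ... | no ¬Xx | no _ = properᵥ _ _ e ∘ inject≤-injective j≤ j≤ _ _

-- Components of induced subgraphs of P₅-free graphs.

-- Three steps, each staying put or moving to one of at most `d` neighbours.
componentBound : ℕ → ℕ
componentBound d = suc d * (suc d * suc d)

-- The head of a nonempty list supplies the fact `Z` on which the bound depends.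
atMost-given : {A Z : Set} {S : A → Set} {a : ℕ} → (Z → AtMost a S) → AtMost a (λ x → Z × S x)
atMost-given bound [] _ _ = z≤n
atMost-given bound xs@(_ ∷ _) u ps@((z , _) ∷ _) = bound z xs u (All.map proj₂ ps)

-- In a P₅-free graph walks of length at most 3 already connect the components of an induced subgraph.
module Components {n} (G : Graph n) (P5-free : ¬ (P 5 ⊑ᵢ G))
  {D : Fin n → Set} (D? : Decidable D) where

  -- Staying put counts as a step, so that `Connected` also allows walks shorter than three.
  Step Connected : Fin n → Fin n → Set
  Step a b = (a ≡ b ⊎ adj G a b ≡ true) × D b
  Connected a x = ∃ λ b → ∃ λ c → Step a b × Step b c × Step c x

  step? : ∀ a b → Dec (Step a b)
  step? a b = (a ≟ b ⊎-dec adj G a b ≟ᵇ true) ×-dec D? b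

  connected? : ∀ a x → Dec (Connected a x)
  connected? a x = any? λ b → any? λ c → step? a b ×-dec step? b c ×-dec step? c x

  connected⇒D : ∀ {a x} → Connected a x → D x
  connected⇒D (_ , _ , _ , _ , _ , Dx) = Dx

  connected-refl : ∀ {a} → D a → Connected a a
  connected-refl Da = _ , _ , (inj₁ refl , Da) , (inj₁ refl , Da) , (inj₁ refl , Da)

  connected-sym : ∀ {a x} → D a → Connected a x → Connected x a
  connected-sym Da (b , c , (ab , Db) , (bc , Dc) , (cx , Dx)) =
    c , b , (reverse cx , Dc) , (reverse bc , Db) , (reverse ab , Da)
    where
    reverse : ∀ {a b} → a ≡ b ⊎ adj G a b ≡ true → b ≡ a ⊎ adj G b a ≡ true
    reverse (inj₁ e) = inj₁ (sym e)
    reverse (inj₂ e) = inj₂ (adj-swap G e)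

  -- A standing step makes room for the new edge. Four genuine steps must have a chord, as they
  -- would otherwise be an induced P₅, and the chord shortens the walk.
  connected-adj : ∀ {a x y} → D a → Connected a x → adj G x y ≡ true → D y → Connected a y
  connected-adj Da (b , c , (inj₁ refl , Db) , bc , cx) xy Dy = c , _ , bc , cx , (inj₂ xy , Dy)
  connected-adj Da (b , c , ab , (inj₁ refl , Dc) , cx) xy Dy = b , _ , ab , cx , (inj₂ xy , Dy)
  connected-adj Da (b , c , ab , bc , (inj₁ refl , Dx)) xy Dy = b , c , ab , bc , (inj₂ xy , Dy)
  connected-adj {a} {x} {y} Da (b , c , (inj₂ ab , Db) , (inj₂ bc , Dc) , (inj₂ cx , Dx)) xy Dy
    with adj-or-not G a c | adj-or-not G a x | adj-or-not G a y
       | adj-or-not G b x | adj-or-not G b y | adj-or-not G c y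
  ... | inj₁ ac | _ | _ | _ | _ | _ = c , x , (inj₂ ac , Dc) , (inj₂ cx , Dx) , (inj₂ xy , Dy)
  ... | _ | inj₁ ax | _ | _ | _ | _ = x , x , (inj₂ ax , Dx) , (inj₁ refl , Dx) , (inj₂ xy , Dy)
  ... | _ | _ | inj₁ ay | _ | _ | _ = y , y , (inj₂ ay , Dy) , (inj₁ refl , Dy) , (inj₁ refl , Dy)
  ... | _ | _ | _ | inj₁ bx | _ | _ = b , x , (inj₂ ab , Db) , (inj₂ bx , Dx) , (inj₂ xy , Dy)
  ... | _ | _ | _ | _ | inj₁ by | _ = b , y , (inj₂ ab , Db) , (inj₂ by , Dy) , (inj₁ refl , Dy)
  ... | _ | _ | _ | _ | _ | inj₁ cy = b , c , (inj₂ ab , Db) , (inj₂ bc , Dc) , (inj₂ cy , Dy)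
  ... | inj₂ ac | inj₂ ax | inj₂ ay | inj₂ bx | inj₂ by | inj₂ cy =
    ⊥-elim (no-P5 G P5-free ab bc cx xy ac ax ay bx by cy)

  connected-step : ∀ {a x y} → D a → Connected a x → Step x y → Connected a y
  connected-step Da ax (inj₁ refl , _) = ax
  connected-step Da ax (inj₂ xy , Dy) = connected-adj Da ax xy Dy

  connected-trans : ∀ {a x y} → D a → Connected a x → Connected x y → Connected a y
  connected-trans Da ax (b , c , xb , bc , cy) =
    connected-step Da (connected-step Da (connected-step Da ax xb) bc) cy

  MixedEdge : Fin n → Fin n → Set
  MixedEdge a w = ∃ λ p → ∃ λ q → Connected a p × Connected a q ×
    adj G w p ≡ true × adj G w q ≡ false × adj G p q ≡ true

  -- On a walk from `x` to `y` the adjacency to `w` changes at some step, which is therefore a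
  -- genuine edge.
  mixed-edge : ∀ {a w x y} → D a → Connected a x → Connected a y →
    adj G w x ≡ true → adj G w y ≡ false →
    MixedEdge a w
  mixed-edge {a} {w} Da ax ay wx wy
    with b , c , xb , bc , cy ← connected-trans (connected⇒D ax) (connected-sym Da ax) ay =
    along ax wx xb λ wb → let ab = connected-step Da ax xb in
    along ab wb bc λ wc → along (connected-step Da ab bc) wc cy λ wy′ → ⊥-elim (adj-not-both G wy′ wy)
    where
    along : ∀ {p q} → Connected a p → adj G w p ≡ true → Step p q →
      (adj G w q ≡ true → MixedEdge a w) → MixedEdge a w
    along {p} {q} ap wp pq continue with adj-or-not G w q
    along {p} {q} ap wp pq continue | inj₁ wq = continue wq
    along {p} {q} ap wp (inj₁ refl , _) continue | inj₂ wq = ⊥-elim (adj-not-both G wp wq)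
    along {p} {q} ap wp s@(inj₂ pq , _) continue | inj₂ wq =
      p , q , ap , connected-step Da ap s , wp , wq , pq

  -- A greedy choice. Both directions are recorded to make the pairwise relation symmetric.
  representatives : ∀ xs → All D xs → ∃ λ ys → All (_∈ xs) ys ×
    AllPairs (λ x y → ¬ Connected x y × ¬ Connected y x) ys ×
    All (λ x → Any (λ y → D y × Connected y x) ys) xs
  representatives [] [] = [] , [] , [] , []
  representatives (x ∷ xs) (Dx ∷ Dxs)
    with ys , ys⊆ , apart , covers ← representatives xs Dxs
    with Any.any? (λ y → D? y ×-dec connected? y x) ys
  ... | yes old = ys , All.map there ys⊆ , apart , old ∷ covers
  ... | no new = x ∷ ys , here refl ∷ All.map there ys⊆
      , All.tabulate (λ {y} y∈ →
          let Dy = All.lookup Dxs (All.lookup ys⊆ y∈)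
              absurd = λ yx → new (lose y∈ (Dy , yx))
          in absurd ∘ connected-sym Dx , absurd) ∷ apart
      , here (Dx , connected-refl Dx) ∷ All.map there covers

  module _ {d} (degree-bounded : ∀ {a} → D a → AtMost d (λ b → adj G a b ≡ true × D b)) where

    step-bounded : ∀ {a} → D a → AtMost (suc d) (Step a)
    step-bounded Da = atMost-⊆
      (λ { (inj₁ e , _) → inj₁ e ; (inj₂ ab , Db) → inj₂ (ab , Db) })
      (atMost-⊎ {a = 1} (atMost-unique (λ p q → trans (sym p) q)) (degree-bounded Da))

    component-bounded : ∀ {a} → D a → AtMost (componentBound d) (Connected a)
    component-bounded {a} Da =
      atMost-⊆ (λ (b , c , ab , bc , cx) → via ab (proj₂ ab , via bc (proj₂ bc , cx)))
        (through Da λ b → atMost-given λ Db → through Db λ c → atMost-given step-bounded)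
      where
      steps : Fin n → List (Fin n)
      steps a = filter (step? a) (allFin n)

      via : ∀ {a b} {S : Fin n → Set} → Step a b → S b → Any S (steps a)
      via {a} {b} ab Sb = lose (∈-filter⁺ (step? a) (∈-allFin b) ab) Sb

      through : ∀ {a m} {R : Fin n → Fin n → Set} → D a → (∀ b → AtMost m (R b)) →
        AtMost (suc d * m) (λ x → Any (λ b → R b x) (steps a))
      through {a} Da bound = atMost-Any bound (steps a)
        (step-bounded Da (steps a) (filter⁺ (step? a) (allFin⁺ n)) (all-filter (step? a) (allFin n)))

-- Bounding the degree of a vertex.

-- The factors count patterns, components sharing a pattern, and vertices of a component.
degreeBound : ℕ → ℕ
degreeBound M = let C = componentBound M in 2 ^ (C * C) * (indexBound M * C)

at : {A : Set} → List A → A → ℕ → A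
at [] d _ = d
at (x ∷ xs) d zero = x
at (x ∷ xs) d (suc p) = at xs d p

at-all : {A : Set} {S : A → Set} {d : A} → S d → ∀ {xs} → All S xs → ∀ p → S (at xs d p)
at-all Sd [] p = Sd
at-all Sd (s ∷ ss) zero = s
at-all Sd (s ∷ ss) (suc p) = at-all Sd ss p

at-index : {A : Set} {d x : A} {xs : List A} (x∈ : x ∈ xs) → at xs d (toℕ (Any.index x∈)) ≡ x
at-index (here refl) = refl
at-index (there x∈) = at-index x∈

module Neighbourhood {n} (G : Graph n) (P5-free : ¬ (P 5 ⊑ᵢ G)) {M}
  (codegree : ∀ {x y} → adj G x y ≡ true → AtMost M (λ a → adj G x a ≡ true × adj G y a ≡ true))
  (rigid : ∀ v (r : Fin n → Fin n) → (∀ x → r x ≢ v) →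
    ¬ (∀ {x y} → adj G x y ≡ true → adj G (r x) (r y) ≡ true))
  (v : Fin n) where

  D : Fin n → Set
  D x = adj G v x ≡ true

  D? : Decidable D
  D? x = adj G v x ≟ᵇ true

  open Components G P5-free D?

  C : ℕ
  C = componentBound M

  C-bounds : ∀ {a} → D a → AtMost C (Connected a)
  C-bounds = component-bounded λ Da →
    atMost-⊆ (λ (ab , Db) → Db , ab) (codegree Da)

  component : Fin n → List (Fin n)
  component a = filter (connected? a) (allFin n)

  -- Positions past the end of the list give `a`. Every component is thus indexed by the same
  -- `Fin C`, with repetitions, which makes patterns of components of different sizes comparable.
  member : Fin n → Fin C → Fin n
  member a p = at (component a) a (toℕ p)

  member-connected : ∀ {a} → D a → ∀ p → Connected a (member a p)
  member-connected {a} Da p = at-all (connected-refl Da) (all-filter (connected? a) (allFin n)) (toℕ p)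

  member-onto : ∀ {a} → D a → ∀ {x} → Connected a x → ∃ λ p → member a p ≡ x
  member-onto {a} Da {x} ax = inject≤ i |component|≤C ,
    trans (cong (at (component a) a) (toℕ-inject≤ i |component|≤C)) (at-index x∈)
    where
    x∈ = ∈-filter⁺ (connected? a) (∈-allFin x) ax
    i = Any.index x∈
    |component|≤C : length (component a) ≤ C
    |component|≤C = C-bounds Da (component a) (filter⁺ (connected? a) (allFin⁺ n))
      (all-filter (connected? a) (allFin n))

  member-adj : Fin n → Fin C → Fin C → Bool
  member-adj a p q = adj G (member a p) (member a q)

  pattern-of : Fin n → Fin (2 ^ (C * C))
  pattern-of a = encode (member-adj a)

  data Status (a w : Fin n) : ℕ → Set where
    none : (∀ {x} → Connected a x → adj G w x ≡ false) → Status a w 0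
    partial : ∀ {x y} → Connected a x → Connected a y →
      adj G w x ≡ true → adj G w y ≡ false → Status a w 1
    complete : (∀ {x} → Connected a x → adj G w x ≡ true) → Status a w 2

  status : ∀ a w → ∃ (Status a w)
  status a w
    with any? (λ x → connected? a x ×-dec adj G w x ≟ᵇ true)
       | any? (λ x → connected? a x ×-dec adj G w x ≟ᵇ false)
  ... | yes (x , ax , wx) | yes (y , ay , wy) = 1 , partial ax ay wx wy
  ... | no none′ | _ = 0 , none λ {x} ax →
          [ (λ wx → contradiction (x , ax , wx) none′) , id ]′ (adj-or-not G w x)
  ... | yes _ | no all = 2 , complete λ {x} ax →
          [ id , (λ wx → contradiction (x , ax , wx) all) ]′ (adj-or-not G w x)

  s : Fin n → Fin n → ℕ
  s w a = proj₁ (status a w)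

  s-status : ∀ w a → Status a w (s w a)
  s-status w a = proj₂ (status a w)

  s≤2 : ∀ w a → s w a ≤ 2
  s≤2 w a with s w a | s-status w a
  ... | _ | none _ = z≤n
  ... | _ | partial _ _ _ _ = s≤s z≤n
  ... | _ | complete _ = ≤-refl

  1≤s : ∀ {w a x} → Connected a x → adj G w x ≡ true → 1 ≤ s w a
  1≤s {w} {a} ax wx with s w a | s-status w a
  ... | _ | none all = ⊥-elim (adj-not-both G wx (all ax))
  ... | _ | partial _ _ _ _ = ≤-refl
  ... | _ | complete _ = s≤s z≤n

  private-neighbour : ∀ {w y a} → D a → s y a < s w a →
    ∃ λ x → Connected a x × adj G w x ≡ true × adj G y x ≡ false
  private-neighbour {w} {y} {a} Da lt with s w a | s-status w a | s y a | s-status y a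
  ... | _ | none _ | _ | _ = contradiction lt λ ()
  ... | _ | partial ax _ wx _ | _ | none all = _ , ax , wx , all ax
  ... | _ | partial _ _ _ _ | _ | partial _ _ _ _ = contradiction lt (<-irrefl refl)
  ... | _ | partial _ _ _ _ | _ | complete _ = contradiction lt λ { (s≤s ()) }
  ... | _ | complete all | _ | none none′ = a , connected-refl Da , all (connected-refl Da) , none′ (connected-refl Da)
  ... | _ | complete all | _ | partial _ ay _ yy = _ , ay , all ay , yy
  ... | _ | complete _ | _ | complete _ = contradiction lt (<-irrefl refl)

  -- Every vertex outside a component of N(v) with a neighbour in it is of this kind.
  Row : Set
  Row = Σ (Fin n) λ w → adj G v w ≡ false

  module _ {m} (a : Fin m → Fin n) (Da : ∀ i → D (a i))
    (apart : ∀ i j → i ≢ j → ¬ Connected (a i) (a j))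
    (same-pattern : ∀ i j → pattern-of (a i) ≡ pattern-of (a j)) where

    A : Fin m → Fin n → Set
    A i = Connected (a i)

    A-disjoint : ∀ {i j x} → A i x → A j x → i ≡ j
    A-disjoint {i} {j} ix jx with i ≟ j
    ... | yes i≡j = i≡j
    ... | no i≢j = contradiction
          (connected-trans (Da i) ix (connected-sym (Da j) jx)) (apart i j i≢j)

    A-anticomplete : ∀ {i j x y} → i ≢ j → A i x → A j y → adj G x y ≡ false
    A-anticomplete {i} {j} {x} {y} i≢j ix jy with adj-or-not G x y
    ... | inj₂ f = f
    ... | inj₁ t = contradiction
          (A-disjoint (connected-adj (Da i) ix t (connected⇒D jy)) jy) i≢j

    same-adj : ∀ i j p q → member-adj (a i) p q ≡ member-adj (a j) p q
    same-adj i j p q = trans (sym (decode-encode (member-adj (a i)) p q))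
      (trans (cong (λ c → decode c p q) (same-pattern i j)) (decode-encode (member-adj (a j)) p q))

    -- Mixed edges of two components would give the induced path q, p, w, p′, q′.
    partial-unique : ∀ {w i j} → s w (a i) ≡ 1 → s w (a j) ≡ 1 → i ≡ j
    partial-unique {w} {i} {j} si sj with i ≟ j
    ... | yes i≡j = i≡j
    ... | no i≢j with s w (a i) | s-status w (a i) | s w (a j) | s-status w (a j)
    ...   | _ | partial ix iy wx wy | _ | partial jx jy wx′ wy′
      with p , q , ip , iq , wp , wq , pq ← mixed-edge (Da i) ix iy wx wy
         | p′ , q′ , jp , jq , wp′ , wq′ , pq′ ← mixed-edge (Da j) jx jy wx′ wy′
      = ⊥-elim (no-P5 G P5-free (adj-swap G pq) (adj-swap G wp) wp′ pq′
          (adj-swap G wq) (A-anticomplete i≢j iq jp) (A-anticomplete i≢j iq jq)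
          (A-anticomplete i≢j ip jp) (A-anticomplete i≢j ip jq) wq′)

    -- With private neighbours `b` of `w` and `c` of `y`, nonadjacent `w` and `y` would be the ends
    -- of an induced path w, b, v, c, y.
    conflict⇒adj : ∀ {w y i j} → adj G v w ≡ false → adj G v y ≡ false →
      s y (a i) < s w (a i) → s w (a j) < s y (a j) → adj G w y ≡ true
    conflict⇒adj {w} {y} {i} {j} vw vy lt gt
      with b , ib , wb , yb ← private-neighbour (Da i) lt
         | c , jc , yc , wc ← private-neighbour (Da j) gt
      with adj-or-not G w y
    ... | inj₁ wy = wy
    ... | inj₂ wy = ⊥-elim (no-P5 G P5-free wb (adj-swap G (connected⇒D ib)) (connected⇒D jc) (adj-swap G yc)
            (adj-swap G vw) wc wy (A-anticomplete i≢j ib jc) (adj-swap G yb) vy)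
      where
      i≢j : i ≢ j
      i≢j refl = <-irrefl refl (<-trans lt gt)

    -- For `b` in `A i` adjacent to `w` but not to `y`, the path c, v, b, w, y would be induced.
    adj⇒no-uncovered : ∀ {w y i j} → adj G v w ≡ false → adj G v y ≡ false → adj G w y ≡ true →
      s y (a i) < s w (a i) → j ≢ i → ∀ {c} → A j c → adj G w c ≡ false → adj G y c ≡ false → ⊥
    adj⇒no-uncovered {w} {y} {i} {j} vw vy wy lt j≢i jc wc yc
      with b , ib , wb , yb ← private-neighbour (Da i) lt =
      no-P5 G P5-free (adj-swap G (connected⇒D jc)) (connected⇒D ib) (adj-swap G wb) wy
        (A-anticomplete j≢i jc ib) (adj-swap G wc) (adj-swap G yc) vw vy (adj-swap G yb)

    adj⇒covers : ∀ {w y i j} → adj G v w ≡ false → adj G v y ≡ false → adj G w y ≡ true →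
      s y (a i) < s w (a i) → j ≢ i → 2 ≤ s w (a j) + s y (a j)
    adj⇒covers {w} {y} {i} {j} vw vy wy lt j≢i
      with uncovered ← (λ {c} → adj⇒no-uncovered vw vy wy lt j≢i {c})
      with s w (a j) | s-status w (a j) | s y (a j) | s-status y (a j)
    ... | _ | none wj | _ | none yj = let jj = connected-refl (Da j) in ⊥-elim (uncovered jj (wj jj) (yj jj))
    ... | _ | none wj | _ | partial _ jc _ yc = ⊥-elim (uncovered jc (wj jc) yc)
    ... | _ | partial _ jc _ wc | _ | none yj = ⊥-elim (uncovered jc wc (yj jc))
    ... | _ | none _ | _ | complete _ = ≤-refl
    ... | _ | partial _ _ _ _ | _ | partial _ _ _ _ = ≤-refl
    ... | _ | partial _ _ _ _ | _ | complete _ = s≤s (s≤s z≤n)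
    ... | _ | complete _ | _ | _ = s≤s (s≤s z≤n)

    -- A sum of 3 means one status is complete and the other not none, hence a common neighbour in
    -- `A i`; disjoint components give different ones.
    adj⇒overlap : ∀ {w y} → adj G w y ≡ true → AtMost M (λ i → 3 ≤ s w (a i) + s y (a i))
    adj⇒overlap {w} {y} wy =
      atMost-transport {T = λ i c → A i c} (codegree wy) (λ {i} → common i) A-disjoint
      where
      common : ∀ i → 3 ≤ s w (a i) + s y (a i) →
        ∃ λ c → (adj G w c ≡ true × adj G y c ≡ true) × A i c
      common i le with s w (a i) | s-status w (a i) | s y (a i) | s-status y (a i)
      ... | _ | complete wa | _ | complete ya =
            _ , (wa (connected-refl (Da i)) , ya (connected-refl (Da i))) , connected-refl (Da i)
      ... | _ | complete wa | _ | partial ic _ yc _ = _ , (wa ic , yc) , ic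
      ... | _ | partial ic _ wc _ | _ | complete ya = _ , (wc , ya ic) , ic
      ... | _ | complete _ | _ | none _ = contradiction le λ { (s≤s (s≤s ())) }
      ... | _ | partial _ _ _ _ | _ | none _ = contradiction le λ { (s≤s ()) }
      ... | _ | partial _ _ _ _ | _ | partial _ _ _ _ = contradiction le λ { (s≤s (s≤s ())) }
      ... | _ | none _ | _ | none _ = contradiction le λ ()
      ... | _ | none _ | _ | partial _ _ _ _ = contradiction le λ { (s≤s ()) }
      ... | _ | none _ | _ | complete _ = contradiction le λ { (s≤s (s≤s ())) }

    -- If A j dominates A i, then folding A i onto A j along the common pattern retracts G onto G − A i.
    dominated⇒⊥ : ∀ {i j} → i ≢ j → ¬ (∀ w → adj G v w ≡ false → s w (a i) ≤ s w (a j))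
    dominated⇒⊥ {i} {j} i≢j dominated = rigid (a i) fold avoids hom
      where
      image : ∀ {x} → A i x → Fin n
      image ix = member (a j) (proj₁ (member-onto (Da i) ix))

      fold : Fin n → Fin n
      fold x with connected? (a i) x
      ... | yes ix = image ix
      ... | no _ = x

      avoids : ∀ x → fold x ≢ a i
      avoids x with connected? (a i) x
      ... | yes ix = λ e → i≢j (sym (A-disjoint
              (subst (A j) e (member-connected (Da j) _)) (connected-refl (Da i))))
      ... | no ¬ix = λ { refl → ¬ix (connected-refl (Da i)) }

      outside : ∀ {x y} → A i x → ¬ A i y → adj G x y ≡ true → ∀ {z} → A j z → adj G y z ≡ true
      outside {x} {y} ix ¬iy xy jz with adj-or-not G v y
      ... | inj₁ vy = contradiction (connected-adj (Da i) ix xy vy) ¬iy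
      ... | inj₂ vy = full jz
        where
        full : A j ⊆ λ z → adj G y z ≡ true
        full with s y (a j) in yj | s-status y (a j) | 1≤s ix (adj-swap G xy) | dominated y vy
        ... | _ | complete all | _ | _ = all
        ... | _ | none _ | 1≤ | ≤0 = contradiction (≤-trans 1≤ ≤0) λ ()
        ... | _ | partial _ _ _ _ | 1≤ | ≤1 = contradiction (partial-unique (≤-antisym ≤1 1≤) yj) i≢j

      hom : ∀ {x y} → adj G x y ≡ true → adj G (fold x) (fold y) ≡ true
      hom {x} {y} xy with connected? (a i) x | connected? (a i) y
      ... | no _ | no _ = xy
      ... | yes ix | no ¬iy = adj-swap G (outside ix ¬iy xy (member-connected (Da j) _))
      ... | no ¬ix | yes iy = outside iy ¬ix (adj-swap G xy) (member-connected (Da j) _)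
      ... | yes ix | yes iy =
        -- Inside `A i` the fold keeps positions; repeated members do no harm, as only edges have to
        -- be preserved.
        trans (sym (same-adj i j _ _))
          (trans (cong₂ (adj G) (proj₂ (member-onto (Da i) ix)) (proj₂ (member-onto (Da i) iy))) xy)

    incomparable : ∀ {i j} → i ≢ j → Σ Row λ (w , _) → s w (a j) < s w (a i)
    incomparable {i} {j} i≢j
      with any? (λ w → adj G v w ≟ᵇ false ×-dec s w (a j) <? s w (a i))
    ... | yes (w , vw , lt) = (w , vw) , lt
    ... | no none′ = ⊥-elim (dominated⇒⊥ i≢j λ w vw → ≮⇒≥ λ lt → none′ (w , vw , lt))

    blocks-bounded : m ≤ indexBound M
    blocks-bounded = subst (_≤ indexBound M) (length-tabulate {n = m} id)
      (indices-bounded (allFin m) (allFin⁺ m) (All.tabulate (λ _ → tt)))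
      where
      indices-bounded : AtMost (indexBound M) (λ (_ : Fin m) → ⊤)
      indices-bounded = Comparability.indices-bounded {Row}
        (λ (w , _) (y , _) → adj G w y ≡ true) (adj-swap G) (λ (w , _) (y , _) → adj G w y ≟ᵇ true)
        _≟_ (λ (w , _) i → s w (a i)) (λ (w , _) i → s≤2 w (a i)) M
        partial-unique
        (λ {(_ , vw)} {(_ , vy)} → conflict⇒adj vw vy)
        (λ {(_ , vw)} {(_ , vy)} → adj⇒covers vw vy)
        adj⇒overlap
        incomparable

  -- Representatives are chosen inside one pattern class, so `blocks-bounded` applies to them, and
  -- their components cover the class.
  degree-bounded : AtMost (degreeBound M) D
  degree-bounded = atMost-⊆ (λ Dx → lose (∈-allFin _) (Dx , refl))
    (atMost-Any {b = 2 ^ (C * C)} with-pattern (allFin (2 ^ (C * C))) (≤-reflexive (length-tabulate {n = 2 ^ (C * C)} id)))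
    where
    with-pattern : ∀ c → AtMost (indexBound M * C) (λ x → D x × pattern-of x ≡ c)
    with-pattern c xs u ps
      with ys , ys⊆ , apart , covers ← representatives xs (All.map proj₁ ps) =
      atMost-Any {b = indexBound M} (λ y → atMost-given C-bounds) ys few xs u covers
      where
      at-y : ∀ i → D (lookup ys i) × pattern-of (lookup ys i) ≡ c
      at-y i = All.lookup ps (All.lookup ys⊆ (∈-lookup i))

      few : length ys ≤ indexBound M
      few = blocks-bounded (lookup ys) (proj₁ ∘ at-y)
        (λ i j i≢j → proj₁ (allPairs-lookup (λ (p , q) → q , p) apart i j i≢j))
        (λ i j → trans (proj₂ (at-y i)) (sym (proj₂ (at-y j))))

-- Bounding the number of vertices.

vertexBound : ℕ → ℕ
vertexBound k = componentBound (degreeBound (ramsey k))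

vertices-bounded : ∀ {n k} (G : Graph n) → VertexCritical k G → Free₂ (P 5) co-K3+2P1 G →
  n ≤ vertexBound k
vertices-bounded {zero} _ _ _ = z≤n
vertices-bounded {suc n} {k} G critical@((colouring , _) , _) (P5-free , co-free) =
  subst (_≤ vertexBound k) (length-tabulate {n = suc n} id)
    (component-bounded (λ {a} → degrees {a}) {zero} tt (allFin _) (allFin⁺ _) (All.tabulate (λ {x} _ → connected x)))
  where
  open Components G P5-free {D = λ _ → ⊤} (λ _ → yes tt)

  connected : ∀ x → Connected zero x
  connected = critical⇒connected {G = G} critical (connected? zero)
    (λ ax xy → connected-adj tt ax xy tt) {zero} (connected-refl tt)

  degrees : ∀ {a} → ⊤ → AtMost (degreeBound (ramsey k)) (λ b → adj G a b ≡ true × ⊤)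
  degrees {a} _ = atMost-⊆ {Ψ = λ b → adj G a b ≡ true} proj₁
    (Neighbourhood.degree-bounded G P5-free (codegree-bounded G colouring co-free)
      (no-proper-endomorphism {G = G} critical) a)

-- Listing all graphs of bounded order.

-- Symmetrising and clearing the diagonal turns every code into a graph, and leaves the matrix of a
-- graph unchanged.
fromMatrix : ∀ {n} → (Fin n → Fin n → Bool) → Graph n
fromMatrix {n} f = record
  { adj = λ u v → adj (K n) u v ∧ (f u v ∨ f v u)
  ; adj-sym = λ u v → cong₂ _∧_ (adj-sym (K n) u v) (∨-comm (f u v) (f v u))
  ; adj-irrefl = λ v → cong (_∧ (f v v ∨ f v v)) (adj-irrefl (K n) v)
  }

≢⇒adj-K : ∀ {n} {u v : Fin n} → u ≢ v → adj (K n) u v ≡ true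
≢⇒adj-K {u = u} {v} u≢v with u ≟ v
... | yes u≡v = contradiction u≡v u≢v
... | no _ = refl

fromMatrix-adj : ∀ {n} (G : Graph n) (f : Fin n → Fin n → Bool) → (∀ u v → f u v ≡ adj G u v) →
  ∀ u v → adj (fromMatrix f) u v ≡ adj G u v
fromMatrix-adj {n} G f f≗ u v with adj-or-not G u v
... | inj₁ t rewrite f≗ u v | t | ≢⇒adj-K (adj⇒≢ G t) = refl
... | inj₂ e rewrite f≗ u v | f≗ v u | adj-sym G v u | e = ∧-zeroʳ _

graphsOn : ∀ n → List AnyGraph
graphsOn n = map (λ c → n , fromMatrix (decode c)) (allFin (2 ^ (n * n)))

graphsUpTo : ℕ → List AnyGraph
graphsUpTo N = concatMap graphsOn (upTo (suc N))

∈-graphsUpTo : ∀ {N n} → n ≤ N → ∀ c → (n , fromMatrix (decode c)) ∈ graphsUpTo N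
∈-graphsUpTo {n = n} n≤N c =
  ∈-concatMap⁺ graphsOn (lose (∈-upTo⁺ (s≤s n≤N))
    (∈-map⁺ (λ c → n , fromMatrix (decode c)) (∈-allFin c)))

theorem4 : (k : ℕ) → 1 ≤ k →
    FinitelyManyUpToIso (λ G → VertexCritical k G × Free₂ (P 5) co-K3+2P1 G)
theorem4 k _ = graphsUpTo (vertexBound k) , λ {n} G (critical , free) →
  let c = encode (adj G) in
  (n , fromMatrix (decode c)) , ∈-graphsUpTo (vertices-bounded G critical free) c ,
  ↔-id (Fin n) , fromMatrix-adj G (decode c) (decode-encode (adj G))
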